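{- For every integer $k\ge 2$ and every positive integer $n$, \[ t_{2k}(n)\le \frac{2k-3}{3}\,\mathrm{ex}(n, C_{2k}). \]
   Context: All graphs are simple. For a graph $G$, $t(G)$ denotes the number of triangles of $G$. A graph is $F$-free if it contains no (not necessarily induced) subgraph isomorphic to $F$. For $\ell\ge 3$, $t_\ell(n)$ is the maximum of $t(G)$ over all $C_\ell$-free graphs on $n$ vertices, $C_\ell$ being the cycle of length $\ell$. $\mathrm{ex}(n,F)$ is the maximum number of edges of an $F$-free graph on $n$ vertices. -}

module Defs where

open import Data.Bool.Base using (Bool; true; false; T; _∧_; _∨_; not; if_then_else_)
open import Data.Bool.Properties using (T?; ∨-comm; ∨-idem; ∧-comm)
open import Data.Fin.Base using (Fin; zero; suc; toℕ; finToFun; funToFin)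
open import Data.Fin.Properties using (any?; all?; finToFun-funToFin)
  renaming (_≟_ to _≟ᶠ_; _<?_ to _<ᶠ?_)
open import Data.List.Base using (List; map; filter; allFin)
open import Data.List.Extrema.Nat using (max; xs≤max; argmax-sel)
open import Data.List.Membership.Propositional using (_∈_)
open import Data.List.Membership.Propositional.Properties
  using (∈-allFin; ∈-map⁺; ∈-map⁻; ∈-filter⁺; ∈-filter⁻)
import Data.List.Relation.Unary.All as All
open import Data.Nat.Base using (ℕ; zero; suc; _≤_; _≡ᵇ_; _^_; z≤n; s≤s)
open import Data.Nat.Properties using (+-0-commutativeMonoid; n≤0⇒n≡0; ≤-reflexive; ≤-trans)
open import Data.Product.Base using (∃; _×_; _,_; proj₁; proj₂)
open import Data.Sum.Base using (inj₁; inj₂)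
open import Function.Base using (_∘_; id)
open import Function.Definitions using (Injective)
open import Relation.Binary.PropositionalEquality
  using (_≡_; _≗_; refl; sym; trans; cong; cong₂; subst; module ≡-Reasoning)
open import Relation.Nullary using (Dec; yes; no; ¬_; ¬?; does)
open import Relation.Nullary.Decidable using (map′; _×-dec_; _→-dec_; dec-true)
open import Relation.Unary using (Decidable)

open import Algebra.Properties.CommutativeMonoid.Sum +-0-commutativeMonoid public
  using (sum; sum-syntax; sum-cong-≗)

private
  variable
    m n : ℕ

record Graph (n : ℕ) : Set where
  field
    adj     : Fin n → Fin n → Bool
    adj-sym : ∀ i j → adj i j ≡ adj j i
    adj-irr : ∀ i → adj i i ≡ false

open Graph public

-- Without function extensionality, _≡_ on graphs would be too fine.
infix 4 _≈_
_≈_ : Graph n → Graph n → Set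
G ≈ H = ∀ i j → adj G i j ≡ adj H i j

fromRel : (Fin n → Fin n → Bool) → Graph n
fromRel r = record
  { adj     = λ i j → not (does (i ≟ᶠ j)) ∧ (r i j ∨ r j i)
  ; adj-sym = λ i j → cong₂ (λ a b → not a ∧ b) (≟-sym i j) (∨-comm (r i j) (r j i))
  ; adj-irr = λ i → cong (λ a → not a ∧ (r i i ∨ r i i)) (dec-true (i ≟ᶠ i) refl)
  }
  where
  ≟-sym : ∀ {n} (i j : Fin n) → does (i ≟ᶠ j) ≡ does (j ≟ᶠ i)
  ≟-sym zero    zero    = refl
  ≟-sym zero    (suc j) = refl
  ≟-sym (suc i) zero    = refl
  ≟-sym (suc i) (suc j) = ≟-sym i j

fromRel-adj : (G : Graph n) → fromRel (adj G) ≈ G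
fromRel-adj G i j with i ≟ᶠ j
... | yes refl = sym (adj-irr G i)
... | no _     = trans (cong (adj G i j ∨_) (adj-sym G j i)) (∨-idem (adj G i j))

fromRel-cong : {r s : Fin n → Fin n → Bool} → (∀ i j → r i j ≡ s i j) → fromRel r ≈ fromRel s
fromRel-cong r≡s i j =
  cong₂ (λ a b → not (does (i ≟ᶠ j)) ∧ (a ∨ b)) (r≡s i j) (r≡s j i)

-- The cycle 0 – 1 – ⋯ – (ℓ-1) – 0.  It is a cycle of length ℓ for ℓ ≥ 3 only.
C : (ℓ : ℕ) → Graph ℓ
C ℓ = fromRel λ i j →
  (suc (toℕ i) ≡ᵇ toℕ j) ∨ ((suc (toℕ i) ≡ᵇ ℓ) ∧ (toℕ j ≡ᵇ 0))

indicator : Bool → ℕ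
indicator b = if b then 1 else 0

infix 5 _<ᵇ_
_<ᵇ_ : Fin n → Fin n → Bool
i <ᵇ j = does (i <ᶠ? j)

edges : Graph n → ℕ
edges {n} G = ∑[ i < n ] ∑[ j < n ] indicator ((i <ᵇ j) ∧ adj G i j)

triangles : Graph n → ℕ
triangles {n} G =
  ∑[ i < n ] ∑[ j < n ] ∑[ k < n ]
    indicator ((i <ᵇ j) ∧ (j <ᵇ k) ∧ adj G i j ∧ adj G j k ∧ adj G i k)

Invariant : (Graph n → ℕ) → Set
Invariant φ = ∀ G H → G ≈ H → φ G ≡ φ H

edges-cong : Invariant (edges {n})
edges-cong G H G≈H = sum-cong-≗ λ i → sum-cong-≗ λ j →
  cong (λ b → indicator ((i <ᵇ j) ∧ b)) (G≈H i j)

triangles-cong : Invariant (triangles {n})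
triangles-cong G H G≈H = sum-cong-≗ λ i → sum-cong-≗ λ j → sum-cong-≗ λ k →
  cong (λ b → indicator ((i <ᵇ j) ∧ (j <ᵇ k) ∧ b))
    (cong₂ _∧_ (G≈H i j) (cong₂ _∧_ (G≈H j k) (G≈H i k)))

-- f maps F isomorphically onto a (not necessarily induced) subgraph of G.
IsEmbedding : Graph m → Graph n → (Fin m → Fin n) → Set
IsEmbedding F G f =
  Injective _≡_ _≡_ f × (∀ u v → T (adj F u v) → T (adj G (f u) (f v)))

Contains : Graph m → Graph n → Set
Contains F G = ∃ (IsEmbedding F G)

Free : Graph m → Graph n → Set
Free F G = ¬ Contains F G

Contains-resp : (F : Graph m) (G H : Graph n) → G ≈ H → Contains F G → Contains F H
Contains-resp F G H G≈H (f , inj , hom) =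
  f , inj , λ u v uv → subst T (G≈H (f u) (f v)) (hom u v uv)

isEmbedding? : (F : Graph m) (G : Graph n) → Decidable (IsEmbedding F G)
isEmbedding? F G f =
  map′ (λ h {u} {v} → h u v) (λ h u v → h {u} {v})
    (all? λ u → all? λ v → (f u ≟ᶠ f v) →-dec (u ≟ᶠ v))
  ×-dec
  all? λ u → all? λ v → T? (adj F u v) →-dec T? (adj G (f u) (f v))

contains? : (F : Graph m) (G : Graph n) → Dec (Contains F G)
contains? F G = map′
  (λ (c , emb) → finToFun c , emb)
  (λ (f , emb) → funToFin f , resp (sym ∘ finToFun-funToFin f) emb)
  (any? (isEmbedding? F G ∘ finToFun))
  where
  resp : ∀ {f g} → f ≗ g → IsEmbedding F G f → IsEmbedding F G g
  resp f≗g (inj , hom) =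
    (λ {u} {v} gu≡gv → inj (trans (f≗g u) (trans gu≡gv (sym (f≗g v))))) ,
    λ u v uv → subst T (cong₂ (adj G) (f≗g u) (f≗g v)) (hom u v uv)

free? : (F : Graph m) → Decidable (Free {n = n} F)
free? F G = ¬? (contains? F G)

-- Each graph on Fin n occurs, up to _≈_, in this list.
allGraphs : (n : ℕ) → List (Graph n)
allGraphs n = map decode (allFin ((2 ^ n) ^ n))
  module AllGraphs where
  bit : Fin 2 → Bool
  bit zero    = false
  bit (suc _) = true

  unbit : Bool → Fin 2
  unbit false = zero
  unbit true  = suc zero

  bit-unbit : ∀ b → bit (unbit b) ≡ b
  bit-unbit false = refl
  bit-unbit true  = refl

  decode : Fin ((2 ^ n) ^ n) → Graph n
  decode c = fromRel λ i j → bit (finToFun {2} {n} (finToFun c i) j)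

  encode : Graph n → Fin ((2 ^ n) ^ n)
  encode G = funToFin λ i → funToFin (unbit ∘ adj G i)

  decode-encode : (G : Graph n) → decode (encode G) ≈ G
  decode-encode G i j = trans (fromRel-cong bits i j) (fromRel-adj G i j)
    where
    bits : ∀ i j → bit (finToFun {2} {n} (finToFun (encode G) i) j) ≡ adj G i j
    bits i j = begin
      bit (finToFun {2} {n} (finToFun (encode G) i) j)
        ≡⟨ cong (λ c → bit (finToFun {2} {n} c j)) (finToFun-funToFin _ i) ⟩
      bit (finToFun (funToFin (unbit ∘ adj G i)) j)
        ≡⟨ cong bit (finToFun-funToFin (unbit ∘ adj G i) j) ⟩
      bit (unbit (adj G i j))
        ≡⟨ bit-unbit (adj G i j) ⟩
      adj G i j ∎
      where open ≡-Reasoning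

allGraphs-complete : (G : Graph n) → ∃ λ H → H ∈ allGraphs n × H ≈ G
allGraphs-complete {n} G =
  decode (encode G) , ∈-map⁺ decode (∈-allFin (encode G)) , decode-encode G
  where open AllGraphs n

-- The maximum of φ over all F-free graphs on n vertices (0 if there are none).
maxFree : (n : ℕ) → Graph m → (Graph n → ℕ) → ℕ
maxFree n F φ = max 0 (map φ (filter (free? F) (allGraphs n)))

ex : (n : ℕ) → Graph m → ℕ
ex n F = maxFree n F edges

t : (ℓ n : ℕ) → ℕ
t ℓ n = maxFree n (C ℓ) triangles

maxFree-upper : (F : Graph m) {φ : Graph n → ℕ} → Invariant φ →
                ∀ G → Free F G → φ G ≤ maxFree n F φ
maxFree-upper {n = n} F {φ} φ-cong G free with allGraphs-complete G
... | H , H∈ , H≈G = subst (_≤ maxFree n F φ) (φ-cong H G H≈G)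
  (All.lookup (xs≤max 0 (map φ (filter (free? F) (allGraphs n))))
    (∈-map⁺ φ (∈-filter⁺ (free? F) H∈ (free ∘ Contains-resp F H G H≈G))))

maxFree-attained : (F : Graph m) {φ : Graph n → ℕ} → Invariant φ →
                   ∃ (Free {n = n} F) → ∃ λ G → Free F G × φ G ≡ maxFree n F φ
maxFree-attained {n = n} F {φ} φ-cong (G₀ , free₀)
  with argmax-sel id 0 (map φ (filter (free? F) (allGraphs n)))
... | inj₁ max≡0 = G₀ , free₀ ,
  trans (n≤0⇒n≡0 (≤-trans (maxFree-upper F {φ} φ-cong G₀ free₀) (≤-reflexive max≡0))) (sym max≡0)
... | inj₂ max∈ with ∈-map⁻ φ max∈
... | G , G∈ , max≡φG = G , proj₂ (∈-filter⁻ (free? F) {xs = allGraphs n} G∈) , sym max≡φG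

edgeless : (n : ℕ) → Graph n
edgeless n = fromRel λ _ _ → false

edgeless-C-free : ∀ {ℓ} → 2 ≤ ℓ → Free (C ℓ) (edgeless n)
edgeless-C-free {n = n} (s≤s (s≤s z≤n)) (f , _ , hom) =
  no-edge (f zero) (f (suc zero)) (hom zero (suc zero) _)
  where
  no-edge : ∀ (i j : Fin n) → ¬ T (adj (edgeless n) i j)
  no-edge i j = subst (¬_ ∘ T) (∧-comm false (not (does (i ≟ᶠ j)))) id

ex-upper : (F : Graph m) (G : Graph n) → Free F G → edges G ≤ ex n F
ex-upper F = maxFree-upper F {edges} edges-cong

ex-attained : ∀ n {ℓ} → 2 ≤ ℓ → ∃ λ (G : Graph n) → Free (C ℓ) G × edges G ≡ ex n (C ℓ)
ex-attained n 2≤ℓ = maxFree-attained (C _) {edges} edges-cong (edgeless n , edgeless-C-free 2≤ℓ)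

t-upper : ∀ ℓ (G : Graph n) → Free (C ℓ) G → triangles G ≤ t ℓ n
t-upper ℓ = maxFree-upper (C ℓ) {triangles} triangles-cong

t-attained : ∀ n {ℓ} → 2 ≤ ℓ → ∃ λ (G : Graph n) → Free (C ℓ) G × triangles G ≡ t ℓ n
t-attained n 2≤ℓ = maxFree-attained (C _) {triangles} triangles-cong (edgeless n , edgeless-C-free 2≤ℓ)

{-# OPTIONS --safe #-}
module Submission where

-- A path on 2k−1 vertices inside a neighbourhood N(v) closes up through v to a C₂ₖ, so N(v)
-- spans no such path, and the Erdős–Gallai theorem bounds its edges by (2k−3)/2 · |N(v)|.
-- Summing over v counts each triangle three times and each edge twice.
--
-- Erdős–Gallai is proved by deletion: take a path that cannot be extended at its ends.
-- With ℓ = 2k−3, if an end vertex has degree at most ℓ/2, delete it.  Otherwise the neighbours of the two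
-- ends cross, so the path's vertices carry a cycle; an edge leaving the cycle would give a
-- longer path, and without such an edge the vertices of the path can be deleted together.

open import Defs
open import Data.Nat.Base as ℕ using (ℕ)
open import Data.Integer.Base as ℤ using (+_)
open import Data.Rational.Base using (_≤_; _*_; _/_)

open import Data.Bool.Base using (Bool; true; false; T; _∧_; _∨_)
open import Data.Bool.Properties using (T?; T-∧; T-∨; T-≡; ∧-assoc)
open import Data.Empty using (⊥; ⊥-elim)
open import Data.Fin.Base using (Fin; zero; suc; toℕ)
open import Data.Fin.Properties using (toℕ-injective)
import Data.Integer.Properties as ℤ
open import Data.List.Base using (List; []; _∷_; _++_; length; map; reverse; filter; tabulate; allFin; lookup)
open import Data.List.Membership.Propositional using (_∈_)
open import Data.List.Membership.Propositional.Properties using (∈-∃++; ∈-++⁺ˡ; ∈-lookup; ∈-filter⁻)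
open import Data.List.Properties using (length-++; map-++; ++-assoc; unfold-reverse)
open import Data.List.Relation.Binary.Permutation.Propositional
  using (_↭_; ↭-refl; ↭-reflexive; ↭-sym; ↭-trans; prep; ↭⇒↭ₛ)
open import Data.List.Relation.Binary.Permutation.Propositional.Properties
  using (map⁺; shift; ++⁺ˡ; ++⁺ʳ; ++-comm; ↭-length; ↭-reverse; ∈-resp-↭)
open import Data.List.Relation.Binary.Permutation.Setoid.Properties using (Unique-resp-↭)
import Data.List.Relation.Unary.All as All
open import Data.List.Relation.Unary.AllPairs using ([]; _∷_)
open import Data.List.Relation.Unary.Any using (here; there)
open import Data.List.Relation.Unary.Unique.Propositional using (Unique)
import Data.List.Relation.Unary.Unique.Propositional.Properties as Unique
open import Data.Nat.ListAction using () renaming (sum to sumᴸ)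
open import Data.Nat.ListAction.Properties using (sum-++; sum-↭)
import Data.Nat.Properties as ℕ
open import Data.Nat.Solver using (module +-*-Solver)
open import Data.Product.Base using (∃; ∃₂; _×_; _,_; proj₂)
open import Data.Rational.Base using (toℚᵘ; fromℚᵘ)
open import Data.Rational.Properties using (toℚᵘ-cancel-≤; toℚᵘ-fromℚᵘ; toℚᵘ-homo-*)
import Data.Rational.Unnormalised.Base as ℚᵘ
import Data.Rational.Unnormalised.Properties as ℚᵘ
open import Data.Sum.Base using (_⊎_; inj₁; inj₂)
open import Function.Base using (_∘_; id)
open import Function.Bundles using (Equivalence)
open import Relation.Binary.Definitions using (tri<; tri≈; tri>)
open import Relation.Binary.PropositionalEquality
  using (_≡_; _≢_; refl; sym; trans; cong; cong₂; subst; subst₂; setoid; module ≡-Reasoning)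
open import Relation.Nullary using (yes; no; contradiction)
open import Algebra.Properties.CommutativeMonoid.Sum ℕ.+-0-commutativeMonoid
  using (∑-comm; ∑-distrib-+)
open import Algebra.Properties.Semiring.Sum ℕ.+-*-semiring using (*-distribˡ-sum)

private
  variable
    A : Set
    n : ℕ

-- Totals over lists, and elementary facts on lists and indicators.

total : (A → ℕ) → List A → ℕ
total f L = sumᴸ (map f L)

total-++ : (f : A → ℕ) (L M : List A) → total f (L ++ M) ≡ total f L ℕ.+ total f M
total-++ f L M = trans (cong sumᴸ (map-++ f L M)) (sum-++ (map f L) (map f M))

total-↭ : (f : A → ℕ) {L M : List A} → L ↭ M → total f L ≡ total f M
total-↭ f L↭M = sum-↭ (map⁺ f L↭M)

total-cong : {f g : A → ℕ} → (∀ u → f u ≡ g u) → (L : List A) → total f L ≡ total g L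
total-cong f≡g []      = refl
total-cong f≡g (u ∷ L) = cong₂ ℕ._+_ (f≡g u) (total-cong f≡g L)

total-zero : (L : List A) → total (λ _ → 0) L ≡ 0
total-zero []      = refl
total-zero (_ ∷ L) = total-zero L

total-+ : (f g : A → ℕ) (L : List A) → total (λ u → f u ℕ.+ g u) L ≡ total f L ℕ.+ total g L
total-+ f g []      = refl
total-+ f g (u ∷ L) rewrite total-+ f g L =
  solve 4 (λ a b c d → (a :+ b) :+ (c :+ d) := (a :+ c) :+ (b :+ d)) refl
    (f u) (g u) (total f L) (total g L)
  where open +-*-Solver

total-comm : (f : A → A → ℕ) (L M : List A) →
             total (λ u → total (f u) M) L ≡ total (λ w → total (λ u → f u w) L) M
total-comm f []      M = sym (total-zero M)
total-comm f (u ∷ L) M = trans (cong (total (f u) M ℕ.+_) (total-comm f L M))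
  (sym (total-+ (f u) (λ w → total (λ u → f u w) L) M))

total-≤ : (f : A → ℕ) {m : ℕ} (L : List A) → (∀ u → u ∈ L → f u ℕ.≤ m) → total f L ℕ.≤ length L ℕ.* m
total-≤ f []      f≤m = ℕ.z≤n
total-≤ f (u ∷ L) f≤m = ℕ.+-mono-≤ (f≤m u (here refl)) (total-≤ f L (λ w → f≤m w ∘ there))

total≢0 : (f : A → ℕ) (L : List A) → total f L ≢ 0 → ∃ λ u → u ∈ L × f u ≢ 0
total≢0 f []      ≢0 = contradiction refl ≢0
total≢0 f (u ∷ L) ≢0 with f u ℕ.≟ 0
... | no fu≢0  = u , here refl , fu≢0
... | yes fu≡0 with total≢0 f L (λ eq → ≢0 (cong₂ ℕ._+_ fu≡0 eq))
... | w , w∈L , fw≢0 = w , there w∈L , fw≢0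

indicator≢0 : (b : Bool) → indicator b ≢ 0 → T b
indicator≢0 false ≢0 = ≢0 refl
indicator≢0 true  ≢0 = _

indicator≤1 : (b : Bool) → indicator b ℕ.≤ 1
indicator≤1 false = ℕ.z≤n
indicator≤1 true  = ℕ.≤-refl

∈⇒↭ : {u : A} {L : List A} → u ∈ L → ∃ λ L′ → L ↭ u ∷ L′
∈⇒↭ {u = u} u∈L with ∈-∃++ u∈L
... | L₁ , L₂ , refl = L₁ ++ L₂ , shift u L₁ L₂

both? : ∀ a b → (T a × T b) ⊎ indicator a ℕ.+ indicator b ℕ.≤ 1
both? true  true  = inj₁ _
both? true  false = inj₂ ℕ.≤-refl
both? false b     = inj₂ (indicator≤1 b)

small-summand : ∀ {ℓ} a b → a ℕ.+ b ℕ.≤ ℓ → 2 ℕ.* a ℕ.≤ ℓ ⊎ 2 ℕ.* b ℕ.≤ ℓ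
small-summand a b a+b≤ℓ with ℕ.≤-total a b
... | inj₁ a≤b = inj₁ (ℕ.≤-trans (ℕ.+-monoʳ-≤ a (ℕ.≤-trans (ℕ.≤-reflexive (ℕ.+-identityʳ a)) a≤b)) a+b≤ℓ)
... | inj₂ b≤a = inj₂ (ℕ.≤-trans (ℕ.+-mono-≤ b≤a (ℕ.≤-reflexive (ℕ.+-identityʳ b))) a+b≤ℓ)

unique-++⁻ˡ : (L : List A) {M : List A} → Unique (L ++ M) → Unique L
unique-++⁻ˡ []      _         = []
unique-++⁻ˡ (u ∷ L) (u∉ ∷ un) = All.tabulate (λ w∈L → All.lookup u∉ (∈-++⁺ˡ w∈L)) ∷ unique-++⁻ˡ L un

lookup-injective : {L : List A} → Unique L → ∀ {i j} → lookup L i ≡ lookup L j → i ≡ j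
lookup-injective {L = _ ∷ _} _         {zero}  {zero}  _  = refl
lookup-injective {L = _ ∷ _} (u∉ ∷ _)  {zero}  {suc j} eq = contradiction eq (All.lookup u∉ (∈-lookup j))
lookup-injective {L = _ ∷ _} (u∉ ∷ _)  {suc i} {zero}  eq = contradiction (sym eq) (All.lookup u∉ (∈-lookup i))
lookup-injective {L = _ ∷ _} (_ ∷ un)  {suc i} {suc j} eq = cong suc (lookup-injective un eq)

-- Degrees and edge counts relative to lists of vertices.

module _ (G : Graph n) where

  private
    V : Set
    V = Fin n

  infix 4 _~_
  _~_ : V → V → Set
  u ~ w = T (adj G u w)

  ~-sym : ∀ {u w} → u ~ w → w ~ u
  ~-sym {u} {w} = subst T (adj-sym G u w)

  deg : V → List V → ℕ
  deg u = total (λ w → indicator (adj G u w))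

  between : List V → List V → ℕ
  between L M = total (λ u → deg u M) L

  between-sym : ∀ L M → between L M ≡ between M L
  between-sym L M = trans (total-comm (λ u w → indicator (adj G u w)) L M)
    (total-cong (λ w → total-cong (λ u → cong indicator (adj-sym G u w)) L) M)

  -- The two cross terms agree because adjacency is symmetric. Once `between M M` is bounded by
  -- induction, the first two terms are what deleting `L` has to pay for.
  between-++ : ∀ L M → between (L ++ M) (L ++ M) ≡ between L L ℕ.+ 2 ℕ.* between L M ℕ.+ between M M
  between-++ L M = begin
    between (L ++ M) (L ++ M)
      ≡⟨ total-++ _ L M ⟩
    between L (L ++ M) ℕ.+ between M (L ++ M)
      ≡⟨ cong₂ ℕ._+_ (split L) (split M) ⟩
    between L L ℕ.+ between L M ℕ.+ (between M L ℕ.+ between M M)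
      ≡⟨ cong (λ e → between L L ℕ.+ between L M ℕ.+ (e ℕ.+ between M M)) (between-sym M L) ⟩
    between L L ℕ.+ between L M ℕ.+ (between L M ℕ.+ between M M)
      ≡⟨ solve 3 (λ a b c → a :+ b :+ (b :+ c) := a :+ con 2 :* b :+ c) refl
           (between L L) (between L M) (between M M) ⟩
    between L L ℕ.+ 2 ℕ.* between L M ℕ.+ between M M ∎
    where
    open ≡-Reasoning
    open +-*-Solver
    split : ∀ K → between K (L ++ M) ≡ between K L ℕ.+ between K M
    split K = trans (total-cong (λ u → total-++ _ L M) K) (total-+ _ _ K)

  between-↭ : ∀ {L M} → L ↭ M → between L L ≡ between M M
  between-↭ {L} L↭M = trans (total-cong (λ u → total-↭ _ L↭M) L) (total-↭ _ L↭M)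

  deg≤length : ∀ u L → deg u L ℕ.≤ length L
  deg≤length u []      = ℕ.z≤n
  deg≤length u (w ∷ L) = ℕ.+-mono-≤ (indicator≤1 (adj G u w)) (deg≤length u L)

  -- The entry `u` itself contributes nothing, adjacency being irreflexive; every other entry
  -- contributes at most 1.
  deg<length : ∀ {u L} → u ∈ L → deg u L ℕ.< length L
  deg<length {u} {_ ∷ L} (here refl) rewrite adj-irr G u = ℕ.s≤s (deg≤length u L)
  deg<length {u} {w ∷ L} (there u∈L) =
    subst (ℕ._≤ ℕ.suc (length L)) (ℕ.+-suc (indicator (adj G u w)) (deg u L))
      (ℕ.+-mono-≤ (indicator≤1 (adj G u w)) (deg<length u∈L))

  deg≢0 : ∀ u L → deg u L ≢ 0 → ∃ λ w → w ∈ L × u ~ w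
  deg≢0 u L ≢0 with total≢0 _ L ≢0
  ... | w , w∈L , uw≢0 = w , w∈L , indicator≢0 _ uw≢0

  -- Paths, their rotations and crossing chords.

  data Path : V → List V → V → Set where
    [_] : ∀ x → Path x (x ∷ []) x
    _∷_ : ∀ {x y L z} → x ~ y → Path y L z → Path x (x ∷ L) z

  head∈ : ∀ {x L z} → Path x L z → x ∈ L
  head∈ [ x ]   = here refl
  head∈ (_ ∷ _) = here refl

  last∈ : ∀ {x L z} → Path x L z → z ∈ L
  last∈ [ x ]   = here refl
  last∈ (_ ∷ p) = there (last∈ p)

  infixr 5 _++⟨_⟩_
  _++⟨_⟩_ : ∀ {x L y x′ M z} → Path x L y → y ~ x′ → Path x′ M z → Path x (L ++ M) z
  [ x ]   ++⟨ e ⟩ q = e ∷ q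
  (f ∷ p) ++⟨ e ⟩ q = f ∷ (p ++⟨ e ⟩ q)

  reverseᴾ : ∀ {x L z} → Path x L z → Path z (reverse L) x
  reverseᴾ [ x ] = [ x ]
  reverseᴾ {x} {_ ∷ L} {z} (e ∷ p) =
    subst (λ M → Path z M x) (sym (unfold-reverse x L)) (reverseᴾ p ++⟨ ~-sym e ⟩ [ x ])

  -- A `Path` has at least one vertex, so the case in which nothing precedes `w` stands apart from
  -- the proper splittings.
  cut : ∀ {x L z w} → Path x L z → w ∈ L →
        w ≡ x ⊎ ∃₂ λ L₁ L₂ → ∃ λ a → L ≡ L₁ ++ L₂ × Path x L₁ a × Path w L₂ z
  cut [ x ]   (here refl) = inj₁ refl
  cut (e ∷ p) (here refl) = inj₁ refl
  cut {x} (e ∷ p) (there w∈L) with cut p w∈L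
  ... | inj₁ refl                        = inj₂ (_ , _ , x , refl , [ x ] , p)
  ... | inj₂ (_ , _ , a , refl , p₁ , p₂) = inj₂ (_ , _ , a , refl , e ∷ p₁ , p₂)

  -- The edge from `z` to `x` closes the path; opening the closed walk just before `w` puts the part
  -- from `w` on first and the part before it last.
  rotate : ∀ {x L z w} → Path x L z → z ~ x → w ∈ L → ∃₂ λ M a → M ↭ L × Path w M a
  rotate p z~x w∈L with cut p w∈L
  ... | inj₁ refl                          = _ , _ , ↭-refl , p
  ... | inj₂ (L₁ , L₂ , a , refl , p₁ , p₂) = _ , a , ++-comm L₂ L₁ , p₂ ++⟨ z~x ⟩ p₁

  -- The counting behind Pósa's and Ore's arguments. If no edge from `a` to the next vertex `b` has
  -- both `q a` and `p b`, each of the `length L - 1` edges contributes at most 1 to the sum of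
  -- these indicators. That sum misses only `p` at the first vertex and `q` at the last, which are
  -- added on the right. For `p = adj G x` and `q = adj G z` these two terms vanish.
  crossing : ∀ {x L z} (p q : V → Bool) → Path x L z →
    (∃₂ λ L₁ L₂ → ∃₂ λ a b → L ≡ L₁ ++ L₂ × Path x L₁ a × Path b L₂ z × T (q a) × T (p b)) ⊎
    total (indicator ∘ p) L ℕ.+ total (indicator ∘ q) L
      ℕ.< length L ℕ.+ (indicator (p x) ℕ.+ indicator (q z))
  crossing p q [ x ] = inj₂ (ℕ.s≤s (ℕ.≤-reflexive
    (cong₂ ℕ._+_ (ℕ.+-identityʳ (indicator (p x))) (ℕ.+-identityʳ (indicator (q x))))))
  crossing {x} {_ ∷ L} {z} p q (_∷_ {y = y} e w) with both? (q x) (p y)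
  ... | inj₁ (qx , py) = inj₁ (_ , _ , x , y , refl , [ x ] , w , qx , py)
  ... | inj₂ ≤1 with crossing p q w
  ... | inj₁ (_ , _ , a , b , refl , w₁ , w₂ , qa , pb) =
    inj₁ (_ , _ , a , b , refl , e ∷ w₁ , w₂ , qa , pb)
  ... | inj₂ < = inj₂ (begin
    ℕ.suc ((px ℕ.+ P) ℕ.+ (qx ℕ.+ Q))
      ≡⟨ solve 4 (λ a b c d → con 1 :+ ((a :+ b) :+ (c :+ d)) := (a :+ c) :+ (con 1 :+ (b :+ d)))
           refl px P qx Q ⟩
    (px ℕ.+ qx) ℕ.+ ℕ.suc (P ℕ.+ Q)
      ≤⟨ ℕ.+-monoʳ-≤ (px ℕ.+ qx) < ⟩
    (px ℕ.+ qx) ℕ.+ (length L ℕ.+ (indicator (p y) ℕ.+ qz))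
      ≡⟨ solve 5 (λ a b l c d → (a :+ b) :+ (l :+ (c :+ d)) := (b :+ c) :+ (l :+ (a :+ d)))
           refl px qx (length L) (indicator (p y)) qz ⟩
    (qx ℕ.+ indicator (p y)) ℕ.+ (length L ℕ.+ (px ℕ.+ qz))
      ≤⟨ ℕ.+-monoˡ-≤ _ ≤1 ⟩
    ℕ.suc (length L ℕ.+ (px ℕ.+ qz)) ∎)
    where
    open ℕ.≤-Reasoning
    open +-*-Solver
    px = indicator (p x)
    qx = indicator (q x)
    qz = indicator (q z)
    P = total (indicator ∘ p) L
    Q = total (indicator ∘ q) L

  -- A crossing pair of chords z–a, x–b with ab an edge of the path closes L up to a cycle.
  respan : ∀ {x L z} → Path x L z →
           (∀ {w} → w ∈ L → ∃₂ λ M a → M ↭ L × Path w M a) ⊎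
           deg x L ℕ.+ deg z L ℕ.< length L
  respan {x} {L} {z} p with crossing (adj G x) (adj G z) p
  ... | inj₂ < rewrite adj-irr G x | adj-irr G z | ℕ.+-identityʳ (length L) = inj₂ <
  ... | inj₁ (L₁ , L₂ , a , b , refl , p₁ , p₂ , za , xb) = inj₁ λ w∈L →
    let M , c , M↭ , q = rotate (p₁ ++⟨ ~-sym za ⟩ reverseᴾ p₂) (~-sym xb) (∈-resp-↭ (↭-sym σ) w∈L)
    in M , c , ↭-trans M↭ σ , q
    where
    σ : L₁ ++ reverse L₂ ↭ L₁ ++ L₂
    σ = ++⁺ˡ L₁ (↭-reverse L₂)

  -- The Erdős-Gallai bound by deletion.

  module _ {ℓ : ℕ} where

    -- Sub-multisets of S are the P with S ↭ P ++ R; an edge within S counts twice in between S S.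
    NoPath : List V → Set
    NoPath S = ∀ {x P z R} → S ↭ P ++ R → Path x P z → length P ≢ 2 ℕ.+ ℓ

    -- Passing from `S` to `R` lowers `between S S` by the left side of the inequality and
    -- `ℓ * length S` by the right side, so the bound for `R` implies the bound for `S`.
    -- Nonemptiness of `P` makes the induction progress.
    Removable : List V → Set
    Removable S = ∃₂ λ P R → S ↭ P ++ R × 1 ℕ.≤ length P ×
      between P P ℕ.+ 2 ℕ.* between P R ℕ.≤ ℓ ℕ.* length P

    -- With `P` the single vertex `u`, `between P P` is 0 by irreflexivity, and only the edges from
    -- `u` to the rest are lost, each counted twice.
    removeVertex : ∀ {S u} → u ∈ S → 2 ℕ.* deg u S ℕ.≤ ℓ → Removable S
    removeVertex {S} {u} u∈S ≤ℓ with ∈⇒↭ u∈S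
    ... | R , S↭u∷R = u ∷ [] , R , S↭u∷R , ℕ.s≤s ℕ.z≤n , bound
      where
      open ℕ.≤-Reasoning
      bound : between (u ∷ []) (u ∷ []) ℕ.+ 2 ℕ.* between (u ∷ []) R ℕ.≤ ℓ ℕ.* 1
      bound rewrite adj-irr G u | ℕ.+-identityʳ (deg u R) | ℕ.*-identityʳ ℓ = begin
        2 ℕ.* deg u R ≤⟨ ℕ.*-monoʳ-≤ 2 (ℕ.m≤n+m (deg u R) (indicator (adj G u u))) ⟩
        2 ℕ.* deg u (u ∷ R) ≡⟨ cong (2 ℕ.*_) (total-↭ _ S↭u∷R) ⟨
        2 ℕ.* deg u S ≤⟨ ≤ℓ ⟩
        ℓ ∎

    -- Each vertex of `P` has fewer than `length P` neighbours in `P`, hence at most `ℓ`, and no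
    -- edge to `R` has to be paid for.
    removePath : ∀ {S} P R → S ↭ P ++ R → 1 ℕ.≤ length P → length P ℕ.≤ 1 ℕ.+ ℓ →
                 between P R ≡ 0 → Removable S
    removePath P R S↭ 1≤ ≤1+ℓ ≡0 = P , R , S↭ , 1≤ , bound
      where
      open ℕ.≤-Reasoning
      bound : between P P ℕ.+ 2 ℕ.* between P R ℕ.≤ ℓ ℕ.* length P
      bound rewrite ≡0 | ℕ.+-identityʳ (between P P) | ℕ.*-comm ℓ (length P) =
        total-≤ _ P λ u u∈P → ℕ.≤-pred (ℕ.≤-trans (deg<length u∈P) ≤1+ℓ)

    -- m bounds the number of vertices still available for extending the path.
    grow : ∀ {S} → NoPath S → ∀ m {x P z R} → length R ℕ.≤ m → S ↭ P ++ R →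
           Path x P z → length P ℕ.≤ 1 ℕ.+ ℓ → Removable S
    grow {S} noPath m {x} {P} {z} {R} R≤m S↭ p P≤ = answer m R≤m
      where
      extend : ∀ m {y w M a} → length R ℕ.≤ m → y ∈ R → y ~ w → M ↭ P → Path w M a → Removable S
      extend m {y} {M = M} R≤m y∈R yw M↭P q with ∈⇒↭ y∈R
      extend ℕ.zero    R≤m y∈R yw M↭P q | R′ , R↭ with ℕ.≤-trans (ℕ.≤-reflexive (sym (↭-length R↭))) R≤m
      ... | ()
      extend (ℕ.suc m) {y} {M = M} R≤m y∈R yw M↭P q | R′ , R↭ =
        grow noPath m (ℕ.≤-pred (ℕ.≤-trans (ℕ.≤-reflexive (sym (↭-length R↭))) R≤m)) S↭′ (yw ∷ q)
          -- The longer path has at most `2 + ℓ` vertices, and `noPath` excludes exactly `2 + ℓ`, so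
          -- the bound `1 + ℓ` persists.
          (ℕ.≤-pred (ℕ.≤∧≢⇒< (ℕ.s≤s (ℕ.≤-trans (ℕ.≤-reflexive (↭-length M↭P)) P≤))
             (noPath S↭′ (yw ∷ q))))
        where
        S↭′ : S ↭ (y ∷ M) ++ R′
        S↭′ = ↭-trans S↭ (↭-trans (++⁺ˡ P R↭) (↭-trans (shift y P R′) (prep y (++⁺ʳ R′ (↭-sym M↭P)))))

      removeEnd : ∀ {u} → u ∈ P → deg u R ≡ 0 → 2 ℕ.* deg u P ℕ.≤ ℓ → Removable S
      removeEnd {u} u∈P ≡0 ≤ℓ = removeVertex
        (∈-resp-↭ (↭-sym S↭) (∈-++⁺ˡ u∈P))
        (subst (λ d → 2 ℕ.* d ℕ.≤ ℓ) (sym degS) ≤ℓ)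
        where
        degS : deg u S ≡ deg u P
        degS = trans (total-↭ _ S↭) (trans (total-++ _ P R)
          (trans (cong (deg u P ℕ.+_) ≡0) (ℕ.+-identityʳ (deg u P))))

      answer : ∀ m → length R ℕ.≤ m → Removable S
      answer m R≤m with deg x R ℕ.≟ 0 | deg z R ℕ.≟ 0
      ... | no x≢0 | _ =
        let y , y∈R , xy = deg≢0 x R x≢0 in extend m R≤m y∈R (~-sym xy) ↭-refl p
      -- `extend` attaches at the first vertex, so the path is reversed to be extended at `z`.
      ... | yes _ | no z≢0 =
        let y , y∈R , zy = deg≢0 z R z≢0 in extend m R≤m y∈R (~-sym zy) (↭-reverse P) (reverseᴾ p)
      ... | yes x≡0 | yes z≡0 with respan p
      -- Both degrees together are less than `length P`, hence at most `ℓ`, so twice the smaller is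
      -- at most `ℓ`. Neither end has a neighbour in `R`, so these are also the degrees in `S`.
      ... | inj₂ < with small-summand (deg x P) (deg z P) (ℕ.≤-pred (ℕ.≤-trans < P≤))
      ... | inj₁ ≤ℓ = removeEnd (head∈ p) x≡0 ≤ℓ
      ... | inj₂ ≤ℓ = removeEnd (last∈ p) z≡0 ≤ℓ
      -- Now `from` yields a path on the vertices of `P` starting at any chosen vertex, so an edge
      -- to `R` from any vertex of `P`, not only from an end, lengthens the path.
      answer m R≤m | yes x≡0 | yes z≡0 | inj₁ from with between P R ℕ.≟ 0
      ... | yes ≡0 = removePath P R S↭ (ℕ.≤-trans (ℕ.s≤s ℕ.z≤n) (deg<length (head∈ p))) P≤ ≡0
      ... | no ≢0 =
        let w , w∈P , w≢0 = total≢0 _ P ≢0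
            y , y∈R , wy  = deg≢0 w R w≢0
            _ , _ , M↭P , q = from w∈P
        in extend m R≤m y∈R (~-sym wy) M↭P q

    -- For a repetition-free `S` the left side is twice the number of edges, giving the classical
    -- bound of `ℓ / 2` edges per vertex. Growing a path from one vertex finds a removable part; the
    -- rest `R` inherits `NoPath`, as a sub-multiset of `R` is one of `S`. The number `m` makes the
    -- recursion structural.
    erdős-gallai : ∀ m S → length S ℕ.≤ m → NoPath S → between S S ℕ.≤ ℓ ℕ.* length S
    erdős-gallai m         []      _   _      = ℕ.z≤n
    erdős-gallai (ℕ.suc m) S@(s ∷ S′) S≤m noPath
      with grow noPath _ ℕ.≤-refl ↭-refl [ s ] (ℕ.s≤s ℕ.z≤n)
    ... | P , R , S↭ , 1≤P , bound = begin
      between S S ≡⟨ between-↭ S↭ ⟩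
      between (P ++ R) (P ++ R) ≡⟨ between-++ P R ⟩
      between P P ℕ.+ 2 ℕ.* between P R ℕ.+ between R R
        ≤⟨ ℕ.+-mono-≤ bound (erdős-gallai m R R≤m λ {_} {P′} {_} {R′} R↭ → noPath (S↭′ P′ R′ R↭)) ⟩
      ℓ ℕ.* length P ℕ.+ ℓ ℕ.* length R ≡⟨ ℕ.*-distribˡ-+ ℓ (length P) (length R) ⟨
      ℓ ℕ.* (length P ℕ.+ length R) ≡⟨ cong (ℓ ℕ.*_) lengths ⟨
      ℓ ℕ.* length S ∎
      where
      open ℕ.≤-Reasoning
      lengths : length S ≡ length P ℕ.+ length R
      lengths = trans (↭-length S↭) (length-++ P)
      R≤m : length R ℕ.≤ m
      R≤m = ℕ.≤-pred (ℕ.≤-trans (ℕ.+-monoˡ-≤ (length R) 1≤P)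
        (ℕ.≤-trans (ℕ.≤-reflexive (sym lengths)) S≤m))
      S↭′ : ∀ P′ R′ → R ↭ P′ ++ R′ → S ↭ P′ ++ (R′ ++ P)
      S↭′ P′ R′ R↭ = ↭-trans S↭ (↭-trans (++-comm P R)
        (↭-trans (++⁺ʳ P R↭) (↭-reflexive (++-assoc P′ R′ P))))

  -- From closed paths to embedded cycles, and paths in neighbourhoods.

  lookup-first : ∀ {x L z} → Path x L z → ∀ i → toℕ i ≡ 0 → lookup L i ≡ x
  lookup-first [ x ]   zero _ = refl
  lookup-first (_ ∷ _) zero _ = refl

  lookup-last : ∀ {x L z} → Path x L z → ∀ i → ℕ.suc (toℕ i) ≡ length L → lookup L i ≡ z
  lookup-last [ x ]           zero    _  = refl
  lookup-last (_ ∷ (_ ∷ _))   zero    ()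
  lookup-last (_ ∷ p)         (suc i) eq = lookup-last p i (ℕ.suc-injective eq)

  lookup-step : ∀ {x L z} → Path x L z → ∀ i j → ℕ.suc (toℕ i) ≡ toℕ j → lookup L i ~ lookup L j
  lookup-step {L = _ ∷ M} (_∷_ {x = x} e p) zero (suc j) eq =
    subst (x ~_) (sym (lookup-first p j (sym (ℕ.suc-injective eq)))) e
  lookup-step [ x ]   zero    zero    ()
  lookup-step (e ∷ p) (suc i) (suc j) eq = lookup-step p i j (ℕ.suc-injective eq)

  -- The embedding sends a position to the vertex found there. A `Path` does not record that its
  -- vertices are distinct, so injectivity comes from `Unique L`.
  cycle⇒Contains : ∀ {x L z} → Path x L z → z ~ x → Unique L → Contains (C (length L)) G
  cycle⇒Contains {x} {L} {z} p zx un = lookup L , lookup-injective un , hom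
    where
    -- This is the relation that `C` symmetrises: either a step along the path or the wrap from the
    -- last position to the first.
    next : Fin (length L) → Fin (length L) → Bool
    next i j = (ℕ.suc (toℕ i) ℕ.≡ᵇ toℕ j) ∨ ((ℕ.suc (toℕ i) ℕ.≡ᵇ length L) ∧ (toℕ j ℕ.≡ᵇ 0))

    next⇒~ : ∀ i j → T (next i j) → lookup L i ~ lookup L j
    next⇒~ i j ij with Equivalence.to (T-∨ {ℕ.suc (toℕ i) ℕ.≡ᵇ toℕ j}) ij
    ... | inj₁ step = lookup-step p i j (ℕ.≡ᵇ⇒≡ _ _ step)
    ... | inj₂ wrap with Equivalence.to (T-∧ {ℕ.suc (toℕ i) ℕ.≡ᵇ length L}) wrap
    ... | i-last , j-first
      rewrite lookup-last p i (ℕ.≡ᵇ⇒≡ _ _ i-last) | lookup-first p j (ℕ.≡ᵇ⇒≡ _ _ j-first) = zx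

    hom : ∀ i j → T (adj (C (length L)) i j) → lookup L i ~ lookup L j
    hom i j ij with Equivalence.to (T-∨ {next i j}) (proj₂ (Equivalence.to T-∧ ij))
    ... | inj₁ i→j = next⇒~ i j i→j
    ... | inj₂ j→i = ~-sym (next⇒~ j i j→i)

  neighbours : V → List V
  neighbours v = filter (T? ∘ adj G v) (allFin _)

  -- Both ends of `P` are adjacent to `v`, so `v ∷ P` closes to a cycle on `3 + ℓ` vertices. They
  -- are distinct: `P` is part of a filtered `allFin`, and `v` is not its own neighbour.
  neighbours-noPath : ∀ {ℓ} → Free (C (3 ℕ.+ ℓ)) G → ∀ v → NoPath {ℓ} (neighbours v)
  neighbours-noPath free v {x} {P} {z} {R} σ p len =
    free (subst (λ m → Contains (C m) G) (cong ℕ.suc len)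
      (cycle⇒Contains (v~ (head∈ p) ∷ p) (~-sym (v~ (last∈ p))) (All.tabulate v≢ ∷ uniqueP)))
    where
    v~ : ∀ {u} → u ∈ P → v ~ u
    v~ u∈P = proj₂ (∈-filter⁻ (T? ∘ adj G v) {xs = allFin _} (∈-resp-↭ (↭-sym σ) (∈-++⁺ˡ u∈P)))
    v≢ : ∀ {u} → u ∈ P → v ≢ u
    v≢ u∈P refl = subst T (adj-irr G v) (v~ u∈P)
    uniqueP : Unique P
    uniqueP = unique-++⁻ˡ P (Unique-resp-↭ (setoid V) (↭⇒↭ₛ σ)
      (Unique.filter⁺ (T? ∘ adj G v) (Unique.allFin⁺ _)))

-- Sums over `Fin n` and their link to list totals.

sum-mono : {f g : Fin n → ℕ} → (∀ i → f i ℕ.≤ g i) → sum f ℕ.≤ sum g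
sum-mono {ℕ.zero}  f≤g = ℕ.z≤n
sum-mono {ℕ.suc n} f≤g = ℕ.+-mono-≤ (f≤g zero) (sum-mono (f≤g ∘ suc))

total-filter : (f : A → ℕ) (p : A → Bool) (g : Fin n → A) →
               total f (filter (T? ∘ p) (tabulate g)) ≡ ∑[ i < n ] (indicator (p (g i)) ℕ.* f (g i))
total-filter {n = ℕ.zero}  f p g = refl
total-filter {n = ℕ.suc n} f p g with p (g zero)
... | true  = cong₂ ℕ._+_ (sym (ℕ.+-identityʳ _)) (total-filter f p (g ∘ suc))
... | false = total-filter f p (g ∘ suc)

length≡total : (L : List A) → length L ≡ total (λ _ → 1) L
length≡total []      = refl
length≡total (_ ∷ L) = cong ℕ.suc (length≡total L)

indicator-∧ : ∀ a b → indicator (a ∧ b) ≡ indicator a ℕ.* indicator b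
indicator-∧ true  b = sym (ℕ.+-identityʳ (indicator b))
indicator-∧ false b = refl

sum³ : (Fin n → Fin n → Fin n → ℕ) → ℕ
sum³ {n} f = ∑[ i < n ] ∑[ j < n ] ∑[ k < n ] f i j k

sum³-cong : {f g : Fin n → Fin n → Fin n → ℕ} → (∀ i j k → f i j k ≡ g i j k) → sum³ f ≡ sum³ g
sum³-cong f≡g = sum-cong-≗ λ i → sum-cong-≗ λ j → sum-cong-≗ (f≡g i j)

sum³-mono : {f g : Fin n → Fin n → Fin n → ℕ} → (∀ i j k → f i j k ℕ.≤ g i j k) → sum³ f ℕ.≤ sum³ g
sum³-mono f≤g = sum-mono λ i → sum-mono λ j → sum-mono (f≤g i j)

sum³-+ : (f g : Fin n → Fin n → Fin n → ℕ) → sum³ (λ i j k → f i j k ℕ.+ g i j k) ≡ sum³ f ℕ.+ sum³ g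
sum³-+ f g = trans
  (sum-cong-≗ λ i → trans
    (sum-cong-≗ λ j → ∑-distrib-+ (f i j) (g i j))
    (∑-distrib-+ (λ j → sum (f i j)) (λ j → sum (g i j))))
  (∑-distrib-+ (λ i → sum (λ j → sum (f i j))) (λ i → sum (λ j → sum (g i j))))

sum³-swap₁₂ : (f : Fin n → Fin n → Fin n → ℕ) → sum³ (λ i j k → f j i k) ≡ sum³ f
sum³-swap₁₂ f = ∑-comm (λ i j → sum (f j i))

sum³-swap₂₃ : (f : Fin n → Fin n → Fin n → ℕ) → sum³ (λ i j k → f i k j) ≡ sum³ f
sum³-swap₂₃ f = sum-cong-≗ λ i → ∑-comm (λ j k → f i k j)

<ᵇ⇒< : (i j : Fin n) → T (i <ᵇ j) → toℕ i ℕ.< toℕ j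
<ᵇ⇒< i j = ℕ.<ᵇ⇒< (toℕ i) (toℕ j)

<⇒<ᵇ : (i j : Fin n) → toℕ i ℕ.< toℕ j → T (i <ᵇ j)
<⇒<ᵇ i j = ℕ.<⇒<ᵇ

-- The six orders of three vertices.

ordered : Fin n → Fin n → Fin n → ℕ
ordered i j k = indicator ((i <ᵇ j) ∧ (j <ᵇ k))

orders : Fin n → Fin n → Fin n → ℕ
orders i j k = ordered i j k ℕ.+ (ordered i k j ℕ.+ (ordered j i k ℕ.+
               (ordered j k i ℕ.+ (ordered k i j ℕ.+ ordered k j i))))

-- Any two of the six orders exclude each other. Asymmetry on each pair and the absence of both
-- cyclic triples suffice, which leaves a finite check on six Booleans.
orders≤1 : (i j k : Fin n) → orders i j k ℕ.≤ 1
orders≤1 i j k = check (i <ᵇ j) (j <ᵇ i) (j <ᵇ k) (k <ᵇ j) (i <ᵇ k) (k <ᵇ i)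
  (asym i j) (asym j k) (asym i k) (acyclic i j k) (acyclic i k j)
  where
  asym : (i j : Fin n) → T (i <ᵇ j) → T (j <ᵇ i) → ⊥
  asym i j ij ji = ℕ.<-asym (<ᵇ⇒< i j ij) (<ᵇ⇒< j i ji)
  acyclic : (i j k : Fin n) → T (i <ᵇ j) → T (j <ᵇ k) → T (k <ᵇ i) → ⊥
  acyclic i j k ij jk ki = ℕ.<-asym (ℕ.<-trans (<ᵇ⇒< i j ij) (<ᵇ⇒< j k jk)) (<ᵇ⇒< k i ki)
  check : ∀ ij ji jk kj ik ki →
    (T ij → T ji → ⊥) → (T jk → T kj → ⊥) → (T ik → T ki → ⊥) →
    (T ij → T jk → T ki → ⊥) → (T ik → T kj → T ji → ⊥) →
    indicator (ij ∧ jk) ℕ.+ (indicator (ik ∧ kj) ℕ.+ (indicator (ji ∧ ik) ℕ.+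
    (indicator (jk ∧ ki) ℕ.+ (indicator (ki ∧ ij) ℕ.+ indicator (kj ∧ ji))))) ℕ.≤ 1
  check true  true  jk    kj    ik    ki    a b c d e = ⊥-elim (a _ _)
  check ij    ji    true  true  ik    ki    a b c d e = ⊥-elim (b _ _)
  check ij    ji    jk    kj    true  true  a b c d e = ⊥-elim (c _ _)
  check true  ji    true  kj    ik    true  a b c d e = ⊥-elim (d _ _ _)
  check ij    true  jk    true  true  ki    a b c d e = ⊥-elim (e _ _ _)
  check true  false true  false true  false a b c d e = ℕ.≤-refl
  check true  false true  false false false a b c d e = ℕ.≤-refl
  check true  false false true  true  false a b c d e = ℕ.≤-refl
  check true  false false true  false true  a b c d e = ℕ.≤-refl
  check true  false false true  false false a b c d e = ℕ.z≤n
  check true  false false false true  false a b c d e = ℕ.z≤n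
  check true  false false false false true  a b c d e = ℕ.≤-refl
  check true  false false false false false a b c d e = ℕ.z≤n
  check false true  true  false true  false a b c d e = ℕ.≤-refl
  check false true  true  false false true  a b c d e = ℕ.≤-refl
  check false true  true  false false false a b c d e = ℕ.z≤n
  check false true  false true  false true  a b c d e = ℕ.≤-refl
  check false true  false true  false false a b c d e = ℕ.≤-refl
  check false true  false false true  false a b c d e = ℕ.≤-refl
  check false true  false false false true  a b c d e = ℕ.z≤n
  check false true  false false false false a b c d e = ℕ.z≤n
  check false false true  false true  false a b c d e = ℕ.z≤n
  check false false true  false false true  a b c d e = ℕ.≤-refl
  check false false true  false false false a b c d e = ℕ.z≤n
  check false false false true  true  false a b c d e = ℕ.≤-refl
  check false false false true  false true  a b c d e = ℕ.z≤n
  check false false false true  false false a b c d e = ℕ.z≤n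
  check false false false false true  false a b c d e = ℕ.z≤n
  check false false false false false true  a b c d e = ℕ.z≤n
  check false false false false false false a b c d e = ℕ.z≤n

-- Double counting of triangles and edges.

module _ (G : Graph n) where

  private
    a : Fin n → Fin n → ℕ
    a i j = indicator (adj G i j)

    a-sym : ∀ i j → a i j ≡ a j i
    a-sym i j = cong indicator (adj-sym G i j)

  -- The indicator of an ordered triangle, symmetric in all three arguments. The bracketing is the
  -- one that arises from filtering twice by adjacency to `i`.
  triple : Fin n → Fin n → Fin n → ℕ
  triple i j k = a i j ℕ.* (a i k ℕ.* a j k)

  triple-swap₁₂ : ∀ i j k → triple i j k ≡ triple j i k
  triple-swap₁₂ i j k = cong₂ ℕ._*_ (a-sym i j) (ℕ.*-comm (a i k) (a j k))

  triple-swap₂₃ : ∀ i j k → triple i j k ≡ triple i k j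
  triple-swap₂₃ i j k rewrite a-sym k j =
    solve 3 (λ x y z → x :* (y :* z) := y :* (x :* z)) refl (a i j) (a i k) (a j k)
    where open +-*-Solver

  triangles≡ : triangles G ≡ sum³ λ i j k → ordered i j k ℕ.* triple i j k
  triangles≡ = sum³-cong λ i j k → begin
    indicator ((i <ᵇ j) ∧ (j <ᵇ k) ∧ adj G i j ∧ adj G j k ∧ adj G i k)
      ≡⟨ cong indicator (∧-assoc (i <ᵇ j) (j <ᵇ k) _) ⟨
    indicator (((i <ᵇ j) ∧ (j <ᵇ k)) ∧ adj G i j ∧ adj G j k ∧ adj G i k)
      ≡⟨ indicator-∧ ((i <ᵇ j) ∧ (j <ᵇ k)) _ ⟩
    ordered i j k ℕ.* indicator (adj G i j ∧ adj G j k ∧ adj G i k)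
      ≡⟨ cong (ordered i j k ℕ.*_) (indicator-∧ (adj G i j) _) ⟩
    ordered i j k ℕ.* (a i j ℕ.* indicator (adj G j k ∧ adj G i k))
      ≡⟨ cong (λ b → ordered i j k ℕ.* (a i j ℕ.* b))
           (trans (indicator-∧ (adj G j k) _) (ℕ.*-comm (a j k) (a i k))) ⟩
    ordered i j k ℕ.* triple i j k ∎
    where open ≡-Reasoning

  -- Since `triple` is symmetric, permuting the summation variables shows that each of the six
  -- orders, used as a weight, gives `triangles G`. The six weights add up to at most 1 at every
  -- triple.
  6*triangles≤ : 6 ℕ.* triangles G ℕ.≤ sum³ triple
  6*triangles≤ = begin
    6 ℕ.* triangles G
      ≡⟨ cong₂ ℕ._+_ t₁ (cong₂ ℕ._+_ t₂ (cong₂ ℕ._+_ t₃ (cong₂ ℕ._+_ t₄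
           (cong₂ ℕ._+_ t₅ (trans (ℕ.+-identityʳ (triangles G)) t₆))))) ⟩
    weighted o₁ ℕ.+ (weighted o₂ ℕ.+ (weighted o₃ ℕ.+ (weighted o₄ ℕ.+ (weighted o₅ ℕ.+ weighted o₆))))
      ≡⟨ merge o₁ (merge o₂ (merge o₃ (merge o₄ (weighted-+ o₅ o₆)))) ⟩
    weighted orders
      ≤⟨ sum³-mono (λ i j k → ℕ.*-monoˡ-≤ (triple i j k) (orders≤1 i j k)) ⟩
    weighted (λ _ _ _ → 1)
      ≡⟨ sum³-cong (λ i j k → ℕ.*-identityˡ (triple i j k)) ⟩
    sum³ triple ∎
    where
    open ℕ.≤-Reasoning
    weighted : (Fin n → Fin n → Fin n → ℕ) → ℕ
    weighted o = sum³ λ i j k → o i j k ℕ.* triple i j k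
    weighted-+ : ∀ o o′ → weighted o ℕ.+ weighted o′ ≡ weighted (λ i j k → o i j k ℕ.+ o′ i j k)
    weighted-+ o o′ = trans
      (sym (sum³-+ (λ i j k → o i j k ℕ.* triple i j k) (λ i j k → o′ i j k ℕ.* triple i j k)))
      (sum³-cong λ i j k → sym (ℕ.*-distribʳ-+ (triple i j k) (o i j k) (o′ i j k)))
    merge : ∀ o {o′ m} → m ≡ weighted o′ →
            weighted o ℕ.+ m ≡ weighted (λ i j k → o i j k ℕ.+ o′ i j k)
    merge o {o′} eq = trans (cong (weighted o ℕ.+_) eq) (weighted-+ o o′)
    swap₁₂ : ∀ o {m} → m ≡ weighted o → m ≡ weighted (λ i j k → o j i k)
    swap₁₂ o eq = trans eq (trans (sym (sum³-swap₁₂ λ i j k → o i j k ℕ.* triple i j k))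
      (sum³-cong λ i j k → cong (o j i k ℕ.*_) (triple-swap₁₂ j i k)))
    swap₂₃ : ∀ o {m} → m ≡ weighted o → m ≡ weighted (λ i j k → o i k j)
    swap₂₃ o eq = trans eq (trans (sym (sum³-swap₂₃ λ i j k → o i j k ℕ.* triple i j k))
      (sum³-cong λ i j k → cong (o i k j ℕ.*_) (triple-swap₂₃ i k j)))
    -- Exchanging the first two or the last two arguments generates all permutations, so every order
    -- is reached from `o₁` by such exchanges.
    o₁ o₂ o₃ o₄ o₅ o₆ : Fin n → Fin n → Fin n → ℕ
    o₁ i j k = ordered i j k
    o₂ i j k = ordered i k j
    o₃ i j k = ordered j i k
    o₄ i j k = ordered j k i
    o₅ i j k = ordered k i j
    o₆ i j k = ordered k j i
    t₁ : triangles G ≡ weighted o₁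
    t₁ = triangles≡
    t₂ : triangles G ≡ weighted o₂
    t₂ = swap₂₃ o₁ t₁
    t₃ : triangles G ≡ weighted o₃
    t₃ = swap₁₂ o₁ t₁
    t₄ : triangles G ≡ weighted o₄
    t₄ = swap₁₂ o₂ t₂
    t₅ : triangles G ≡ weighted o₅
    t₅ = swap₂₃ o₃ t₃
    t₆ : triangles G ≡ weighted o₆
    t₆ = swap₁₂ o₅ t₅

  degree : Fin n → ℕ
  degree v = ∑[ u < n ] a v u

  length-neighbours : ∀ v → length (neighbours G v) ≡ degree v
  length-neighbours v = trans (length≡total (neighbours G v))
    (trans (total-filter (λ _ → 1) (adj G v) id) (sum-cong-≗ λ u → ℕ.*-identityʳ (a v u)))

  -- Each membership in `neighbours G v` becomes a factor `a v u` or `a v w`. The common value is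
  -- twice the number of triangles at `v`.
  between-neighbours : ∀ v → between G (neighbours G v) (neighbours G v) ≡
                       ∑[ u < n ] ∑[ w < n ] triple v u w
  between-neighbours v = begin
    between G (neighbours G v) (neighbours G v)
      ≡⟨ total-filter _ (adj G v) id ⟩
    ∑[ u < n ] (a v u ℕ.* deg G u (neighbours G v))
      ≡⟨ sum-cong-≗ (λ u → cong (a v u ℕ.*_) (total-filter (a u) (adj G v) id)) ⟩
    ∑[ u < n ] (a v u ℕ.* (∑[ w < n ] (a v w ℕ.* a u w)))
      ≡⟨ sum-cong-≗ (λ u → *-distribˡ-sum (a v u) (λ w → a v w ℕ.* a u w)) ⟩
    ∑[ u < n ] ∑[ w < n ] triple v u w ∎
    where open ≡-Reasoning

  -- Half of the handshake lemma: an adjacent pair is counted by `edges` in one of its two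
  -- orientations, and the diagonal contributes 0.
  ∑degree≤2*edges : ∑[ v < n ] degree v ℕ.≤ 2 ℕ.* edges G
  ∑degree≤2*edges = begin
    ∑[ i < n ] ∑[ j < n ] a i j
      ≤⟨ sum-mono (λ i → sum-mono (orient i)) ⟩
    ∑[ i < n ] ∑[ j < n ] (e i j ℕ.+ e j i)
      ≡⟨ sum-cong-≗ (λ i → ∑-distrib-+ (e i) (λ j → e j i)) ⟩
    ∑[ i < n ] (sum (e i) ℕ.+ (∑[ j < n ] e j i))
      ≡⟨ ∑-distrib-+ (λ i → sum (e i)) (λ i → ∑[ j < n ] e j i) ⟩
    edges G ℕ.+ (∑[ i < n ] ∑[ j < n ] e j i)
      ≡⟨ cong (edges G ℕ.+_) (∑-comm (λ i j → e j i)) ⟩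
    edges G ℕ.+ edges G
      ≡⟨ cong (edges G ℕ.+_) (ℕ.+-identityʳ (edges G)) ⟨
    2 ℕ.* edges G ∎
    where
    open ℕ.≤-Reasoning
    e : Fin n → Fin n → ℕ
    e i j = indicator ((i <ᵇ j) ∧ adj G i j)
    e-true : ∀ i j → toℕ i ℕ.< toℕ j → e i j ≡ a i j
    e-true i j i<j rewrite Equivalence.to T-≡ (<⇒<ᵇ i j i<j) = refl
    orient : ∀ i j → a i j ℕ.≤ e i j ℕ.+ e j i
    orient i j with ℕ.<-cmp (toℕ i) (toℕ j)
    ... | tri< i<j _ _ = subst (ℕ._≤ e i j ℕ.+ e j i) (e-true i j i<j) (ℕ.m≤m+n (e i j) (e j i))
    ... | tri> _ _ j<i = subst (ℕ._≤ e i j ℕ.+ e j i) (trans (e-true j i j<i) (a-sym j i)) (ℕ.m≤n+m (e j i) (e i j))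
    ... | tri≈ _ i≡j _ rewrite toℕ-injective i≡j | adj-irr G j = ℕ.z≤n

  3*triangles≤ : ∀ ℓ → Free (C (3 ℕ.+ ℓ)) G → 3 ℕ.* triangles G ℕ.≤ ℓ ℕ.* edges G
  -- Doubling turns the left side into the count of ordered triples and matches the factor 2 from
  -- the degree sum on the right.
  3*triangles≤ ℓ free = ℕ.*-cancelˡ-≤ 2 (begin
    2 ℕ.* (3 ℕ.* triangles G) ≡⟨ ℕ.*-assoc 2 3 (triangles G) ⟨
    6 ℕ.* triangles G ≤⟨ 6*triangles≤ ⟩
    sum³ triple ≡⟨ sum-cong-≗ between-neighbours ⟨
    ∑[ v < n ] between G (neighbours G v) (neighbours G v)
      ≤⟨ sum-mono (λ v → erdős-gallai G _ (neighbours G v) ℕ.≤-refl (neighbours-noPath G free v)) ⟩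
    ∑[ v < n ] (ℓ ℕ.* length (neighbours G v))
      ≡⟨ sum-cong-≗ (λ v → cong (ℓ ℕ.*_) (length-neighbours v)) ⟩
    ∑[ v < n ] (ℓ ℕ.* degree v) ≡⟨ *-distribˡ-sum ℓ degree ⟨
    ℓ ℕ.* (∑[ v < n ] degree v) ≤⟨ ℕ.*-monoʳ-≤ ℓ ∑degree≤2*edges ⟩
    ℓ ℕ.* (2 ℕ.* edges G)
      ≡⟨ solve 2 (λ l e → l :* (con 2 :* e) := con 2 :* (l :* e)) refl ℓ (edges G) ⟩
    2 ℕ.* (ℓ ℕ.* edges G) ∎)
    where
    open ℕ.≤-Reasoning
    open +-*-Solver

-- Passage to the extremal numbers and to rationals.

3*t≤ℓ*ex : ∀ ℓ n → 3 ℕ.* t (3 ℕ.+ ℓ) n ℕ.≤ ℓ ℕ.* ex n (C (3 ℕ.+ ℓ))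
3*t≤ℓ*ex ℓ n =
  -- A graph attaining `t` is itself free of the cycle, so its edge count is at most `ex`.
  let G , free , triangles≡t = t-attained n {3 ℕ.+ ℓ} (ℕ.s≤s (ℕ.s≤s ℕ.z≤n))
  in subst (λ m → 3 ℕ.* m ℕ.≤ ℓ ℕ.* ex n (C (3 ℕ.+ ℓ))) triangles≡t
       (ℕ.≤-trans (3*triangles≤ G ℓ free) (ℕ.*-monoʳ-≤ ℓ (ex-upper (C (3 ℕ.+ ℓ)) G free)))

-- `_/_` reduces to lowest terms, so the comparison is made in the unnormalised rationals, where it
-- is the cross-multiplication `a * 3 ≤ (ℓ * b) * 1`. `mkℚᵘ` takes the denominator minus one: 0 and
-- 2 stand for 1 and 3.
/-≤ : ∀ ℓ a b → 3 ℕ.* a ℕ.≤ ℓ ℕ.* b → (+ a) / 1 ≤ ((+ ℓ) / 3) * ((+ b) / 1)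
/-≤ ℓ a b 3a≤ℓb = toℚᵘ-cancel-≤ (begin
  toℚᵘ (fromℚᵘ (ℚᵘ.mkℚᵘ (+ a) 0))
    ≃⟨ toℚᵘ-fromℚᵘ (ℚᵘ.mkℚᵘ (+ a) 0) ⟩
  ℚᵘ.mkℚᵘ (+ a) 0
    ≤⟨ ℚᵘ.*≤* (subst₂ ℤ._≤_ (ℤ.pos-* a 3) (trans (ℤ.pos-* (ℓ ℕ.* b) 1) (cong (ℤ._* + 1) (ℤ.pos-* ℓ b)))
         (ℤ.+≤+ (subst₂ ℕ._≤_ (ℕ.*-comm 3 a) (sym (ℕ.*-identityʳ _)) 3a≤ℓb))) ⟩
  ℚᵘ.mkℚᵘ (+ ℓ) 2 ℚᵘ.* ℚᵘ.mkℚᵘ (+ b) 0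
    ≃⟨ ℚᵘ.*-cong (toℚᵘ-fromℚᵘ (ℚᵘ.mkℚᵘ (+ ℓ) 2)) (toℚᵘ-fromℚᵘ (ℚᵘ.mkℚᵘ (+ b) 0)) ⟨
  toℚᵘ ((+ ℓ) / 3) ℚᵘ.* toℚᵘ ((+ b) / 1)
    ≃⟨ toℚᵘ-homo-* ((+ ℓ) / 3) ((+ b) / 1) ⟨
  toℚᵘ (((+ ℓ) / 3) * ((+ b) / 1)) ∎)
  where open ℚᵘ.≤-Reasoning

-- `2 * k` has the form `3 + ℓ` only up to a propositional equation, hence the variable `m`. After
-- rewriting, `+ (3 + ℓ) - + 3` computes to `+ ℓ`.
bound : ∀ ℓ {m} n → m ≡ 3 ℕ.+ ℓ →
        (+ t m n) / 1 ≤ ((+ m ℤ.- + 3) / 3) * ((+ ex n (C m)) / 1)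
bound ℓ {m} n m≡3+ℓ = subst
  (λ z → (+ t m n) / 1 ≤ (z / 3) * ((+ ex n (C m)) / 1))
  (sym (cong (λ j → + j ℤ.- + 3) m≡3+ℓ))
  (/-≤ ℓ (t m n) (ex n (C m))
    (subst (λ j → 3 ℕ.* t j n ℕ.≤ ℓ ℕ.* ex n (C j)) (sym m≡3+ℓ) (3*t≤ℓ*ex ℓ n)))

theorem1 : ∀ (k n : ℕ) → 2 ℕ.≤ k → 1 ℕ.≤ n →
    (+ t (2 ℕ.* k) n) / 1 ≤ ((+ (2 ℕ.* k) ℤ.- + 3) / 3) * ((+ ex n (C (2 ℕ.* k))) / 1)
theorem1 k n 2≤k _ = bound (2 ℕ.* k ℕ.∸ 3) n
  -- From `2 ≤ k` follows `3 ≤ 4 ≤ 2 * k`, so the truncated subtraction of 3 is exact.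
  (sym (ℕ.m+[n∸m]≡n (ℕ.≤-trans (ℕ.n≤1+n 3) (ℕ.*-monoʳ-≤ 2 2≤k))))
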